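{- Let $G$ be a graph on $n$ vertices with a proper edge-coloring. If $G$ has at least $32n\log^2(5n)$ edges, then $G$ contains a rainbow cycle.
   Context: A proper edge-coloring assigns colors to edges so that any two edges sharing a vertex receive different colors. A subgraph is rainbow if all of its edges receive distinct colors. Here $\log$ denotes the base-$2$ logarithm. -}

module Defs where

open import Data.Nat using (ℕ; zero; suc; _+_; _*_; _^_; _<_; _≤_; _<?_)
open import Data.Nat.DivMod using (_mod_)
open import Data.Fin using (Fin; toℕ)
open import Data.List using (List; length; filter; allFin; cartesianProduct)
open import Data.Product using (_×_; _,_; proj₁; proj₂)
open import Function.Definitions using (Injective)
open import Relation.Binary.PropositionalEquality using (_≡_)
open import Relation.Nullary using (¬_; Dec)
open import Relation.Nullary.Decidable using (_×-dec_)

record Graph (n : ℕ) : Set₁ where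
  field
    Adj   : Fin n → Fin n → Set
    adj?  : (u v : Fin n) → Dec (Adj u v)
    sym   : ∀ {u v} → Adj u v → Adj v u
    irrfl : ∀ {u} → ¬ Adj u u
open Graph public

edgeCount : ∀ {n} → Graph n → ℕ
edgeCount {n} G =
  length (filter (λ p → (toℕ (proj₁ p) <? toℕ (proj₂ p)) ×-dec adj? G (proj₁ p) (proj₂ p))
                 (cartesianProduct (allFin n) (allFin n)))

record ProperEdgeColouring {n : ℕ} (G : Graph n) : Set where
  field
    col    : Fin n → Fin n → ℕ
    col-sym : ∀ {u v} → Adj G u v → col u v ≡ col v u
    proper : ∀ {u v w} → Adj G u v → Adj G u w → ¬ (v ≡ w) → ¬ (col u v ≡ col u w)
open ProperEdgeColouring public

next : ∀ {k} → Fin (suc k) → Fin (suc k)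
next {k} i = suc (toℕ i) mod (suc k)

record RainbowCycle {n : ℕ} (G : Graph n) (c : ProperEdgeColouring G) : Set where
  field
    k        : ℕ
    vtx      : Fin (3 + k) → Fin n
    vtx-inj  : Injective _≡_ _≡_ vtx
    edges    : ∀ i → Adj G (vtx i) (vtx (next i))
    rainbow  : Injective _≡_ _≡_ (λ i → col c (vtx i) (vtx (next i)))

-- Hypothesis  m ≥ 32 n (log₂ (5n))²  for n ≥ 1, stated without reals:
-- for every positive rational p/q with (p/q)² > m/(32n) we have log₂(5n) < p/q,
-- i.e. (5n)^q < 2^p.  (This is equivalent, by density of ℚ in ℝ.)
ManyEdges : ℕ → ℕ → Set
ManyEdges n m = ∀ (p q : ℕ) → 0 < q → m * (q * q) < 32 * n * (p * p) → (5 * n) ^ q < 2 ^ p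

{-# OPTIONS --safe #-}

-- Pass to a subgraph of large minimum degree δ ≥ 8K², where 2^(K-1) ≤ n < 2^K, by deleting
-- vertices of small degree.  Weight a closed walk by ∏ 1/deg over its vertices, so that the total
-- weight of closed walks of length 2m is t(m) = tr P^(2m), P being the random walk matrix.
--
-- A closed walk whose steps i < j share a colour contributes to ∑_c tr (P^p B_c P^q B_c), where
-- B_c is the part of P of colour c and p + q = 2m.  As P and the B_c are self-adjoint, this sum
-- satisfies a midpoint inequality in p, hence is largest at p = 0; there it is at most t(m)/δ,
-- because ∑_c B_c² is diagonal with entries at most 1/δ.  So, unless there is a rainbow closed
-- walk (which contains a rainbow cycle), t(m+1) ≤ (2m+2)(2m+1) t(m)/δ, and since t(0) = n this
-- gives t(K) ≤ n (4K²/δ)^K ≤ n/2^K < 1.  But t(K) ≥ 1, since P has eigenvalue 1.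
--
-- Everything is kept in ℕ by scaling the weights 1/deg by L, the product of all degrees.
module Submission where

open import Algebra.Bundles using (Monoid)
import Algebra.Properties.CommutativeMonoid.Sum
import Algebra.Properties.Semiring.Sum
open import Data.Fin using (Fin; zero; suc; toℕ; fromℕ<; punchIn)
import Data.Fin.Properties as Fin
open import Data.List using (List; []; _∷_; _++_; length; filter; map; tabulate; cartesianProduct)
open import Data.List.Properties using (filter-++; length-++; map-tabulate)
open import Data.Nat using (ℕ; zero; suc; _+_; _*_; _∸_; _^_; _%_; _≤_; _<_; z≤n; s≤s; s≤s⁻¹; _<?_; _≟_; >-nonZero)
open import Data.Nat.DivMod using (m%n<n; m<n⇒m%n≡m; n%n≡0)
open import Data.Nat.Induction using (<-rec)
open import Data.Nat.Properties hiding (_≟_; _<?_)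
open import Data.Nat.Tactic.RingSolver using (solve-∀)
open import Data.Product using (_×_; _,_; proj₁; proj₂; ∃-syntax)
open import Data.Sum using (_⊎_; inj₁; inj₂)
open import Defs renaming (sym to Adj-sym)
open import Function using (_∘_)
open import Level using (0ℓ)
open import Relation.Binary.Definitions using (tri<; tri≈; tri>)
open import Relation.Binary.PropositionalEquality hiding (J)
open import Relation.Nullary using (¬_; Dec; yes; no; contradiction)
open import Relation.Nullary.Decidable using (_×-dec_)
open import Relation.Unary using (Decidable; Pred)

-- Finite sums of natural numbers and indicators

module ∑ = Algebra.Properties.Semiring.Sum +-*-semiring
module ∏ = Algebra.Properties.CommutativeMonoid.Sum *-1-commutativeMonoid
open ∑ using (sum; sum-syntax; sum-cong-≗; ∑-comm; ∑-distrib-+; *-distribˡ-sum; *-distribʳ-sum)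

sum-mono-≤ : ∀ {n} {f g : Fin n → ℕ} → (∀ i → f i ≤ g i) → sum f ≤ sum g
sum-mono-≤ {zero}  f≤g = z≤n
sum-mono-≤ {suc n} f≤g = +-mono-≤ (f≤g zero) (sum-mono-≤ (f≤g ∘ suc))

sum-zero : ∀ {n} {f : Fin n → ℕ} → (∀ i → f i ≡ 0) → sum f ≡ 0
sum-zero {n} f≡0 = trans (sum-cong-≗ f≡0) (∑.sum-replicate-zero n)

sum-pos : ∀ {n} (f : Fin n → ℕ) → 0 < sum f → ∃[ i ] 0 < f i
sum-pos {suc n} f 0<∑ with f zero in eq
... | suc _ = zero , subst (0 <_) (sym eq) (s≤s z≤n)
... | zero  with sum-pos (f ∘ suc) 0<∑
...   | i , 0<fi = suc i , 0<fi

⟦_⟧ : ∀ {P : Set} → Dec P → ℕ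
⟦ yes _ ⟧ = 1
⟦ no  _ ⟧ = 0

⟦⟧-yes : ∀ {P : Set} (d : Dec P) → P → ⟦ d ⟧ ≡ 1
⟦⟧-yes (yes _) _ = refl
⟦⟧-yes (no ¬p) p = contradiction p ¬p

⟦⟧-no : ∀ {P : Set} (d : Dec P) → ¬ P → ⟦ d ⟧ ≡ 0
⟦⟧-no (yes p) ¬p = contradiction p ¬p
⟦⟧-no (no _)  _  = refl

sum-δ : ∀ {n} (f : Fin n → ℕ) j → ∑[ i < n ] (⟦ j Fin.≟ i ⟧ * f i) ≡ f j
sum-δ {suc n} f j = begin
  ∑[ i < suc n ] (⟦ j Fin.≟ i ⟧ * f i)
    ≡⟨ ∑.sum-remove {i = j} (λ i → ⟦ j Fin.≟ i ⟧ * f i) ⟩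
  ⟦ j Fin.≟ j ⟧ * f j + ∑[ k < n ] (⟦ j Fin.≟ punchIn j k ⟧ * f (punchIn j k))
    ≡⟨ cong₂ _+_ (trans (cong (_* f j) (⟦⟧-yes (j Fin.≟ j) refl)) (*-identityˡ (f j)))
                 (sum-zero λ k → cong (_* f (punchIn j k)) (⟦⟧-no (j Fin.≟ _) (Fin.punchInᵢ≢i j k ∘ sym))) ⟩
  f j + 0 ≡⟨ +-identityʳ (f j) ⟩
  f j ∎
  where open ≡-Reasoning

-- Matrices over ℕ: products, powers and traces

Mat : ℕ → Set
Mat n = Fin n → Fin n → ℕ

infix  4 _≋_
infixl 7 _⊗_

-- A record rather than a bare family of equations, so that the two matrices can be read off from
-- the type of a proof.
record _≋_ {n} (X Y : Mat n) : Set where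
  constructor ext
  field at : ∀ i j → X i j ≡ Y i j
open _≋_

_⊗_ : ∀ {n} → Mat n → Mat n → Mat n
_⊗_ {n} X Y i j = ∑[ k < n ] (X i k * Y k j)

𝟙 : ∀ {n} → Mat n
𝟙 i j = ⟦ i Fin.≟ j ⟧

tr : ∀ {n} → Mat n → ℕ
tr {n} X = ∑[ i < n ] X i i

⊗-cong : ∀ {n} {X X′ Y Y′ : Mat n} → X ≋ X′ → Y ≋ Y′ → X ⊗ Y ≋ X′ ⊗ Y′
⊗-cong p q = ext λ i j → sum-cong-≗ λ k → cong₂ _*_ (at p i k) (at q k j)

⊗-assoc : ∀ {n} (X Y Z : Mat n) → (X ⊗ Y) ⊗ Z ≋ X ⊗ (Y ⊗ Z)
⊗-assoc {n} X Y Z = ext λ i j → begin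
  ∑[ k < n ] ((∑[ l < n ] (X i l * Y l k)) * Z k j)
    ≡⟨ sum-cong-≗ (λ k → *-distribʳ-sum (Z k j) (λ l → X i l * Y l k)) ⟩
  ∑[ k < n ] ∑[ l < n ] (X i l * Y l k * Z k j)
    ≡⟨ ∑-comm (λ k l → X i l * Y l k * Z k j) ⟩
  ∑[ l < n ] ∑[ k < n ] (X i l * Y l k * Z k j)
    ≡⟨ sum-cong-≗ (λ l → sum-cong-≗ λ k → *-assoc (X i l) (Y l k) (Z k j)) ⟩
  ∑[ l < n ] ∑[ k < n ] (X i l * (Y l k * Z k j))
    ≡⟨ sum-cong-≗ (λ l → *-distribˡ-sum (X i l) (λ k → Y l k * Z k j)) ⟨
  ∑[ l < n ] (X i l * (∑[ k < n ] (Y l k * Z k j))) ∎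
  where open ≡-Reasoning

⊗-identityˡ : ∀ {n} (X : Mat n) → 𝟙 ⊗ X ≋ X
⊗-identityˡ X = ext λ i j → sum-δ (λ k → X k j) i

𝟙-sym : ∀ {n} (i j : Fin n) → 𝟙 i j ≡ 𝟙 j i
𝟙-sym i j with i Fin.≟ j
... | yes i≡j = sym (⟦⟧-yes (j Fin.≟ i) (sym i≡j))
... | no  i≢j = sym (⟦⟧-no (j Fin.≟ i) (i≢j ∘ sym))

⊗-identityʳ : ∀ {n} (X : Mat n) → X ⊗ 𝟙 ≋ X
⊗-identityʳ X = ext λ i j → trans
  (sum-cong-≗ λ k → trans (*-comm (X i k) (𝟙 k j)) (cong (_* X i k) (𝟙-sym k j)))
  (sum-δ (X i) j)

⊗-monoid : ℕ → Monoid 0ℓ 0ℓ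
⊗-monoid n = record
  { Carrier = Mat n
  ; _≈_ = _≋_
  ; _∙_ = _⊗_
  ; ε = 𝟙
  ; isMonoid = record
    { isSemigroup = record
      { isMagma = record
        { isEquivalence = record
          { refl  = ext λ _ _ → refl
          ; sym   = λ p → ext λ i j → sym (at p i j)
          ; trans = λ p q → ext λ i j → trans (at p i j) (at q i j)
          }
        ; ∙-cong = ⊗-cong
        }
      ; assoc = ⊗-assoc
      }
    ; identity = ⊗-identityˡ , ⊗-identityʳ
    }
  }

module ⊗ {n : ℕ} where
  open Monoid (⊗-monoid n) public using () renaming (refl to ≋-refl; sym to ≋-sym; trans to ≋-trans)
  open import Algebra.Properties.Monoid.Mult (⊗-monoid n) public
  open import Algebra.Solver.Monoid (⊗-monoid n) public using (solve; _⊜_) renaming (_⊕_ to _⊙_)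

open ⊗ using (≋-refl; ≋-sym; ≋-trans)

infixr 8 _↑_
-- The multiple of a monoid element, read multiplicatively: `X ↑ suc k` unfolds to `X ⊗ X ↑ k`.
_↑_ : ∀ {n} → Mat n → ℕ → Mat n
X ↑ k = k ⊗.× X

↑-+ : ∀ {n} (X : Mat n) p q → X ↑ p ⊗ X ↑ q ≋ X ↑ (p + q)
↑-+ X p q = ≋-sym (⊗.×-homo-+ X p q)

tr-cong : ∀ {n} {X Y : Mat n} → X ≋ Y → tr X ≡ tr Y
tr-cong p = sum-cong-≗ λ i → at p i i

tr-comm : ∀ {n} (X Y : Mat n) → tr (X ⊗ Y) ≡ tr (Y ⊗ X)
tr-comm {n} X Y = trans (∑-comm (λ i k → X i k * Y k i))
  (sum-cong-≗ λ k → sum-cong-≗ λ i → *-comm (X i k) (Y k i))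

-- Adjoint matrices and the AM-GM inequality for traces

2xy≤x²+y² : ∀ x y → 2 * (x * y) ≤ x * x + y * y
2xy≤x²+y² x y with ≤-total x y
... | inj₁ x≤y with m≤n⇒∃[o]m+o≡n x≤y
...   | d , refl = subst (2 * (x * (x + d)) ≤_) (lemma x d) (m≤m+n _ (d * d))
  where lemma : ∀ x d → 2 * (x * (x + d)) + d * d ≡ x * x + (x + d) * (x + d)
        lemma = solve-∀
2xy≤x²+y² x y | inj₂ y≤x with m≤n⇒∃[o]m+o≡n y≤x
...   | d , refl = subst (2 * ((y + d) * y) ≤_) (lemma y d) (m≤m+n _ (d * d))
  where lemma : ∀ y d → 2 * ((y + d) * y) + d * d ≡ (y + d) * (y + d) + y * y
        lemma = solve-∀

-- Adjointness for the inner product of functions on `Fin n` with weights `π`. For `X = Y` it is the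
-- detailed balance equation.
record Adjoint {n} (π : Fin n → ℕ) (X Y : Mat n) : Set where
  constructor adj
  field rev : ∀ u v → π u * X u v ≡ π v * Y v u
open Adjoint

⊗-adjoint : ∀ {n} {π : Fin n → ℕ} {X X′ Y Y′} →
            Adjoint π X X′ → Adjoint π Y Y′ → Adjoint π (X ⊗ Y) (Y′ ⊗ X′)
⊗-adjoint {n} {π} {X} {X′} {Y} {Y′} p q = adj λ u v → begin
  π u * (∑[ k < n ] (X u k * Y k v))
    ≡⟨ *-distribˡ-sum (π u) (λ k → X u k * Y k v) ⟩
  ∑[ k < n ] (π u * (X u k * Y k v))
    ≡⟨ sum-cong-≗ (λ k → step u v k) ⟩
  ∑[ k < n ] (π v * (Y′ v k * X′ k u))
    ≡⟨ *-distribˡ-sum (π v) (λ k → Y′ v k * X′ k u) ⟨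
  π v * (∑[ k < n ] (Y′ v k * X′ k u)) ∎
  where
  open ≡-Reasoning
  swap : ∀ a x y → a * x * y ≡ x * (a * y)
  swap = solve-∀
  step : ∀ u v k → π u * (X u k * Y k v) ≡ π v * (Y′ v k * X′ k u)
  step u v k = begin
    π u * (X u k * Y k v)   ≡⟨ *-assoc (π u) _ _ ⟨
    π u * X u k * Y k v     ≡⟨ cong (_* Y k v) (rev p u k) ⟩
    π k * X′ k u * Y k v    ≡⟨ swap (π k) (X′ k u) (Y k v) ⟩
    X′ k u * (π k * Y k v)  ≡⟨ cong (X′ k u *_) (rev q k v) ⟩
    X′ k u * (π v * Y′ v k) ≡⟨ *-comm (X′ k u) _ ⟩
    π v * Y′ v k * X′ k u   ≡⟨ *-assoc (π v) _ _ ⟩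
    π v * (Y′ v k * X′ k u) ∎

𝟙-adjoint : ∀ {n} {π : Fin n → ℕ} → Adjoint π 𝟙 𝟙
𝟙-adjoint {π = π} = adj go
  where
  go : ∀ u v → π u * 𝟙 u v ≡ π v * 𝟙 v u
  go u v with u Fin.≟ v
  ... | yes refl = cong (π u *_) (sym (⟦⟧-yes (u Fin.≟ u) refl))
  ... | no  u≢v  = trans (*-zeroʳ (π u)) (sym (trans (cong (π v *_) (⟦⟧-no (v Fin.≟ u) (u≢v ∘ sym))) (*-zeroʳ (π v))))

≋-adjoint : ∀ {n} {π : Fin n → ℕ} {X Y Z : Mat n} → Adjoint π X Y → Y ≋ Z → Adjoint π X Z
≋-adjoint {π = π} p q = adj λ u v → trans (rev p u v) (cong (π v *_) (at q v u))

↑-comm : ∀ {n} (X : Mat n) k → X ↑ k ⊗ X ≋ X ↑ suc k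
↑-comm X k = ≋-trans (⊗-cong (≋-refl {x = X ↑ k}) (≋-sym (⊗.×-homo-1 X)))
  (≋-trans (↑-+ X k 1) (⊗.×-congˡ (+-comm k 1)))

↑-adjoint : ∀ {n} {π : Fin n → ℕ} {X} → Adjoint π X X → ∀ k → Adjoint π (X ↑ k) (X ↑ k)
↑-adjoint p zero    = 𝟙-adjoint
↑-adjoint p (suc k) = ≋-adjoint (⊗-adjoint p (↑-adjoint p k)) (↑-comm _ k)

-- This is `tr ((X - Y) (X - Y)*) ≥ 0`, rearranged to avoid subtraction. After multiplication by
-- `π v`, adjointness turns the entries of `X′` and `Y′` into those of `X` and `Y`, and each summand
-- is a case of `2xy ≤ x² + y²`.
tr-amgm : ∀ {n} {π : Fin n → ℕ} → (∀ v → 0 < π v) → ∀ {X X′ Y Y′} →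
          Adjoint π X X′ → Adjoint π Y Y′ →
          tr (X ⊗ Y′) + tr (Y ⊗ X′) ≤ tr (X ⊗ X′) + tr (Y ⊗ Y′)
tr-amgm {n} {π} π>0 {X} {X′} {Y} {Y′} p q = begin
  tr (X ⊗ Y′) + tr (Y ⊗ X′) ≡⟨ merge X Y′ Y X′ ⟨
  ∑[ u < n ] ∑[ v < n ] (X u v * Y′ v u + Y u v * X′ v u)
    ≤⟨ sum-mono-≤ (λ u → sum-mono-≤ λ v → pointwise u v) ⟩
  ∑[ u < n ] ∑[ v < n ] (X u v * X′ v u + Y u v * Y′ v u) ≡⟨ merge X X′ Y Y′ ⟩
  tr (X ⊗ X′) + tr (Y ⊗ Y′) ∎
  where
  open ≤-Reasoning
  merge : ∀ (A B C D : Mat n) → ∑[ u < n ] ∑[ v < n ] (A u v * B v u + C u v * D v u) ≡ tr (A ⊗ B) + tr (C ⊗ D)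
  merge A B C D = trans (sum-cong-≗ λ u → ∑-distrib-+ (λ v → A u v * B v u) (λ v → C u v * D v u))
                        (∑-distrib-+ (λ u → (A ⊗ B) u u) (λ u → (C ⊗ D) u u))
  lemma₁ : ∀ b x x′ y y′ → b * (x * y′ + y * x′) ≡ x * (b * y′) + y * (b * x′)
  lemma₁ = solve-∀
  lemma₂ : ∀ a x y → x * (a * y) + y * (a * x) ≡ a * (2 * (x * y))
  lemma₂ = solve-∀
  lemma₃ : ∀ a x y → a * (x * x + y * y) ≡ x * (a * x) + y * (a * y)
  lemma₃ = solve-∀
  lemma₄ : ∀ b x x′ y y′ → x * (b * x′) + y * (b * y′) ≡ b * (x * x′ + y * y′)
  lemma₄ = solve-∀
  pointwise : ∀ u v → X u v * Y′ v u + Y u v * X′ v u ≤ X u v * X′ v u + Y u v * Y′ v u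
  pointwise u v = *-cancelˡ-≤ (π v) {{>-nonZero (π>0 v)}} (begin
    π v * (x * y′ + y * x′)       ≡⟨ lemma₁ (π v) x x′ y y′ ⟩
    x * (π v * y′) + y * (π v * x′) ≡⟨ cong₂ (λ s t → x * s + y * t) (sym (rev q u v)) (sym (rev p u v)) ⟩
    x * (π u * y) + y * (π u * x) ≡⟨ lemma₂ (π u) x y ⟩
    π u * (2 * (x * y))           ≤⟨ *-monoʳ-≤ (π u) (2xy≤x²+y² x y) ⟩
    π u * (x * x + y * y)         ≡⟨ lemma₃ (π u) x y ⟩
    x * (π u * x) + y * (π u * y) ≡⟨ cong₂ (λ s t → x * s + y * t) (rev p u v) (rev q u v) ⟩
    x * (π v * x′) + y * (π v * y′) ≡⟨ lemma₄ (π v) x x′ y y′ ⟩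
    π v * (x * x′ + y * y′)       ∎)
    where x = X u v ; x′ = X′ v u ; y = Y u v ; y′ = Y′ v u

-- Closed walks with two marked steps: the midpoint inequality

argmax : ∀ (f : ℕ → ℕ) N → ∃[ p ] p ≤ N × (∀ q → q ≤ N → f q ≤ f p)
argmax f zero = 0 , z≤n , λ { zero z≤n → ≤-refl }
argmax f (suc N) with argmax f N
... | p , p≤N , max with ≤-total (f p) (f (suc N))
...   | inj₁ fp≤ = suc N , ≤-refl , λ q q≤ → bound q (m≤n⇒m<n∨m≡n q≤)
  where bound : ∀ q → q < suc N ⊎ q ≡ suc N → f q ≤ f (suc N)
        bound q (inj₁ q<) = ≤-trans (max q (s≤s⁻¹ q<)) fp≤
        bound q (inj₂ refl) = ≤-refl
...   | inj₂ ≤fp = p , m≤n⇒m≤1+n p≤N , λ q q≤ → bound q (m≤n⇒m<n∨m≡n q≤)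
  where bound : ∀ q → q < suc N ⊎ q ≡ suc N → f q ≤ f p
        bound q (inj₁ q<) = max q (s≤s⁻¹ q<)
        bound q (inj₂ refl) = ≤fp

-- Cyclic invariance of the trace moves `d` to the front, where it joins `a` to form one of the two
-- arcs between the factors `b`.
tr-rotate : ∀ {n} (a b a′ d′ d : Mat n) →
            tr ((a ⊗ (b ⊗ a′)) ⊗ (d′ ⊗ (b ⊗ d))) ≡ tr (((d ⊗ a) ⊗ b) ⊗ ((a′ ⊗ d′) ⊗ b))
tr-rotate a b a′ d′ d = begin
  tr ((a ⊗ (b ⊗ a′)) ⊗ (d′ ⊗ (b ⊗ d)))
    ≡⟨ tr-cong (⊗.solve 5 (λ a b a′ d′ d → (a ⊙ (b ⊙ a′)) ⊙ (d′ ⊙ (b ⊙ d)) ⊜ (a ⊙ (b ⊙ (a′ ⊙ (d′ ⊙ b)))) ⊙ d) ≋-refl a b a′ d′ d) ⟩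
  tr ((a ⊗ (b ⊗ (a′ ⊗ (d′ ⊗ b)))) ⊗ d)
    ≡⟨ tr-comm (a ⊗ (b ⊗ (a′ ⊗ (d′ ⊗ b)))) d ⟩
  tr (d ⊗ (a ⊗ (b ⊗ (a′ ⊗ (d′ ⊗ b)))))
    ≡⟨ tr-cong (⊗.solve 5 (λ a b a′ d′ d → d ⊙ (a ⊙ (b ⊙ (a′ ⊙ (d′ ⊙ b)))) ⊜ ((d ⊙ a) ⊙ b) ⊙ ((a′ ⊙ d′) ⊙ b)) ≋-refl a b a′ d′ d) ⟩
  tr (((d ⊗ a) ⊗ b) ⊗ ((a′ ⊗ d′) ⊗ b)) ∎
  where open ≡-Reasoning
        open ⊗ using (_⊜_; _⊙_)

module Repeat {n N : ℕ} (P : Mat n) (B : Fin N → Mat n) where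

  -- For `B c` the part of `P` of colour `c`: the weight of closed walks of length `p + q + 2` with
  -- two marked steps of colour `c`, which leave arcs of `p` and `q` arbitrary steps.
  repeat : ℕ → ℕ → Fin N → ℕ
  repeat p q c = tr ((P ↑ p ⊗ B c) ⊗ (P ↑ q ⊗ B c))

  R : ℕ → ℕ → ℕ
  R p q = ∑[ c < N ] repeat p q c

  R-comm : ∀ p q → R p q ≡ R q p
  R-comm p q = sum-cong-≗ λ c → tr-comm (P ↑ p ⊗ B c) (P ↑ q ⊗ B c)

  -- Cuts the closed walk inside both arcs, so that each of the two pieces holds one marked step.
  repeat-split : ∀ s s′ t t′ c →
    tr ((P ↑ s ⊗ (B c ⊗ P ↑ s′)) ⊗ (P ↑ t′ ⊗ (B c ⊗ P ↑ t))) ≡ repeat (t + s) (s′ + t′) c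
  repeat-split s s′ t t′ c = trans (tr-rotate (P ↑ s) (B c) (P ↑ s′) (P ↑ t′) (P ↑ t))
    (tr-cong (⊗-cong (⊗-cong (↑-+ P t s) ≋-refl) (⊗-cong (↑-+ P s′ t′) ≋-refl)))

  module _ {π : Fin n → ℕ} (π>0 : ∀ v → 0 < π v)
           (P-adj : Adjoint π P P) (B-adj : ∀ c → Adjoint π (B c) (B c)) where

    path-adjoint : ∀ s s′ c → Adjoint π (P ↑ s ⊗ (B c ⊗ P ↑ s′)) (P ↑ s′ ⊗ (B c ⊗ P ↑ s))
    path-adjoint s s′ c = ≋-adjoint
      (⊗-adjoint (↑-adjoint P-adj s) (⊗-adjoint (B-adj c) (↑-adjoint P-adj s′)))
      (⊗-assoc (P ↑ s′) (B c) (P ↑ s))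

    -- Apply `tr-amgm` to the paths with `s` and `s′`, respectively `t` and `t′`, steps around the
    -- marked one. Their adjoints are the reversed paths. A path closed up by its own reversal has
    -- doubled arcs; closed up by the reversal of the other path, it has the mixed arcs `s + t` and
    -- `s′ + t′`.
    R-amgm : ∀ s s′ t t′ → 2 * R (s + t) (s′ + t′) ≤ R (s + s) (s′ + s′) + R (t + t) (t′ + t′)
    R-amgm s s′ t t′ = begin
      2 * R (s + t) (s′ + t′)
        ≡⟨ cong₂ _+_ (cong (λ x → R x (s′ + t′)) (+-comm s t))
             (trans (+-identityʳ _) (cong (R (s + t)) (+-comm s′ t′))) ⟩
      R (t + s) (s′ + t′) + R (s + t) (t′ + s′)
        ≡⟨ ∑-distrib-+ (repeat (t + s) (s′ + t′)) (repeat (s + t) (t′ + s′)) ⟨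
      ∑[ c < N ] (repeat (t + s) (s′ + t′) c + repeat (s + t) (t′ + s′) c)
        ≡⟨ sum-cong-≗ (λ c → cong₂ _+_ (repeat-split s s′ t t′ c) (repeat-split t t′ s s′ c)) ⟨
      _ ≤⟨ sum-mono-≤ (λ c → tr-amgm π>0 (path-adjoint s s′ c) (path-adjoint t t′ c)) ⟩
      _ ≡⟨ sum-cong-≗ (λ c → cong₂ _+_ (repeat-split s s′ s s′ c) (repeat-split t t′ t t′ c)) ⟩
      ∑[ c < N ] (repeat (s + s) (s′ + s′) c + repeat (t + t) (t′ + t′) c)
        ≡⟨ ∑-distrib-+ (repeat (s + s) (s′ + s′)) (repeat (t + t) (t′ + t′)) ⟩
      R (s + s) (s′ + s′) + R (t + t) (t′ + t′) ∎
      where open ≤-Reasoning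

    -- At a maximiser p ≤ m of R p (2m ∸ p), R-amgm gives
    -- 2 R p (2m ∸ p) ≤ R 0 (2m) + R (2p) (2m ∸ 2p) ≤ R 0 (2m) + R p (2m ∸ p).
    R-max : ∀ m p q → p + q ≡ m + m → R p q ≤ R 0 (m + m)
    R-max m p q p+q = ≤-trans (max p q p+q) (centre (≤-total p* q*))
      where
      f : ℕ → ℕ
      f p = R p (m + m ∸ p)
      best = argmax f (m + m)
      p* = proj₁ best
      q* = m + m ∸ p*
      p*+q* : p* + q* ≡ m + m
      p*+q* = m+[n∸m]≡n (proj₁ (proj₂ best))
      max : ∀ p q → p + q ≡ m + m → R p q ≤ R p* q*
      max p q eq = subst (λ z → R p z ≤ R p* q*)
        (trans (cong (_∸ p) (sym eq)) (m+n∸m≡n p q))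
        (proj₂ (proj₂ best) p (subst (p ≤_) eq (m≤m+n p q)))
      low : ∀ p q → p ≤ q → p + q ≡ m + m → (∀ p′ q′ → p′ + q′ ≡ m + m → R p′ q′ ≤ R p q) → R p q ≤ R 0 (m + m)
      low p q p≤q eq max with m≤n⇒∃[o]m+o≡n p≤m
        where p≤m : p ≤ m
              p≤m = ≮⇒≥ λ m<p → <⇒≢ (+-mono-< m<p (<-≤-trans m<p p≤q)) (sym eq)
      ... | d , refl = +-cancelʳ-≤ (R p q) _ _ (begin
        R p q + R p q ≡⟨ cong (R p q +_) (+-identityʳ _) ⟨
        2 * R p q     ≡⟨ cong (λ z → 2 * R p z) q≡ ⟩
        2 * R (0 + p) (p + d + d) ≤⟨ R-amgm 0 (p + d) p d ⟩
        R 0 (p + d + (p + d)) + R (p + p) (d + d) ≤⟨ +-monoʳ-≤ _ (max (p + p) (d + d) (arith p d)) ⟩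
        R 0 (p + d + (p + d)) + R p q ∎)
        where
        open ≤-Reasoning
        arith : ∀ p d → p + p + (d + d) ≡ p + d + (p + d)
        arith = solve-∀
        arith′ : ∀ p d → p + d + (p + d) ≡ p + (p + d + d)
        arith′ = solve-∀
        q≡ : q ≡ p + d + d
        q≡ = +-cancelˡ-≡ p _ _ (trans eq (arith′ p d))
      -- Only the shorter arc can be doubled within `m + m`; `R-comm` exchanges the arcs when that
      -- is `q*`.
      centre : p* ≤ q* ⊎ q* ≤ p* → R p* q* ≤ R 0 (m + m)
      centre (inj₁ p≤q) = low p* q* p≤q p*+q* max
      centre (inj₂ q≤p) = subst (_≤ R 0 (m + m)) (R-comm q* p*)
        (low q* p* q≤p (trans (+-comm q* p*) p*+q*)
          λ p′ q′ eq → subst (R p′ q′ ≤_) (R-comm p* q*) (max p′ q′ eq))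

-- Weighted sums over walks and the counting of repeated colours

tr-⊗-+ : ∀ {n} (W X Y : Mat n) → tr (W ⊗ λ u v → X u v + Y u v) ≡ tr (W ⊗ X) + tr (W ⊗ Y)
tr-⊗-+ {n} W X Y = trans
  (sum-cong-≗ λ u → trans (sum-cong-≗ λ v → *-distribˡ-+ (W u v) (X v u) (Y v u))
                          (∑-distrib-+ (λ v → W u v * X v u) (λ v → W u v * Y v u)))
  (∑-distrib-+ (λ u → (W ⊗ X) u u) (λ u → (W ⊗ Y) u u))

tr-⊗-∑ : ∀ {n N} (W : Mat n) (X : Fin N → Mat n) →
         tr (W ⊗ λ u v → ∑[ c < N ] X c u v) ≡ ∑[ c < N ] tr (W ⊗ X c)
tr-⊗-∑ {n} {N} W X = begin
  ∑[ u < n ] ∑[ v < n ] (W u v * (∑[ c < N ] X c v u))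
    ≡⟨ sum-cong-≗ (λ u → sum-cong-≗ λ v → *-distribˡ-sum (W u v) (λ c → X c v u)) ⟩
  ∑[ u < n ] ∑[ v < n ] ∑[ c < N ] (W u v * X c v u)
    ≡⟨ sum-cong-≗ (λ u → ∑-comm (λ v c → W u v * X c v u)) ⟩
  ∑[ u < n ] ∑[ c < N ] ∑[ v < n ] (W u v * X c v u)
    ≡⟨ ∑-comm (λ u c → ∑[ v < n ] (W u v * X c v u)) ⟩
  ∑[ c < N ] tr (W ⊗ X c) ∎
  where open ≡-Reasoning

count : ℕ → List ℕ → ℕ
count k []       = 0
count k (c ∷ cs) = ⟦ k ≟ c ⟧ + count k cs

-- The number of pairs of positions with equal entries. Counting pairs makes its sum over walks
-- split into one term per pair of steps.
repeats : List ℕ → ℕ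
repeats []       = 0
repeats (c ∷ cs) = count c cs + repeats cs

-- A walk is a function on all of ℕ of which only the values up to `ℓ` matter, so that dropping the
-- first step is composition with `suc`.
colours : ∀ {n} → (Fin n → Fin n → ℕ) → (ℕ → Fin n) → ℕ → List ℕ
colours col x zero    = []
colours col x (suc ℓ) = col (x 0) (x 1) ∷ colours col (x ∘ suc) ℓ

-- Read from right to left, this turns a dependence on the colour of a step into a sum over all
-- colours below `N`.
sum-⟦⟧-toℕ : ∀ {N} (h : ℕ → ℕ) k → k < N → ∑[ c < N ] (⟦ toℕ c ≟ k ⟧ * h (toℕ c)) ≡ h k
sum-⟦⟧-toℕ {N} h k k<N = begin
  ∑[ c < N ] (⟦ toℕ c ≟ k ⟧ * h (toℕ c)) ≡⟨ sum-cong-≗ (λ c → cong (_* h (toℕ c)) (δ≡ c)) ⟩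
  ∑[ c < N ] (⟦ fromℕ< k<N Fin.≟ c ⟧ * h (toℕ c)) ≡⟨ sum-δ (h ∘ toℕ) (fromℕ< k<N) ⟩
  h (toℕ (fromℕ< k<N)) ≡⟨ cong h (Fin.toℕ-fromℕ< k<N) ⟩
  h k ∎
  where
  open ≡-Reasoning
  δ≡ : ∀ c → ⟦ toℕ c ≟ k ⟧ ≡ ⟦ fromℕ< k<N Fin.≟ c ⟧
  δ≡ c with toℕ c ≟ k
  ... | yes refl = sym (⟦⟧-yes (fromℕ< k<N Fin.≟ c) (Fin.fromℕ<-toℕ c k<N))
  ... | no  c≢k  = sym (⟦⟧-no (fromℕ< k<N Fin.≟ c) λ { refl → c≢k (Fin.toℕ-fromℕ< k<N) })

module Walks {n : ℕ} (P : Mat n) (col : Fin n → Fin n → ℕ) where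

  -- Sums, over walks of length `ℓ` from `u` to `w`, the weight of the walk times `g` of its list of
  -- colours. The recursion absorbs the colour of the first step into `g`.
  walkSum : ℕ → (List ℕ → ℕ) → Mat n
  walkSum zero    g u w = 𝟙 u w * g []
  walkSum (suc ℓ) g u w = ∑[ v < n ] (P u v * walkSum ℓ (λ cs → g (col u v ∷ cs)) v w)

  walkSum-mono : ∀ ℓ {g h} → (∀ cs → g cs ≤ h cs) → ∀ u w → walkSum ℓ g u w ≤ walkSum ℓ h u w
  walkSum-mono zero    g≤h u w = *-monoʳ-≤ (𝟙 u w) (g≤h [])
  walkSum-mono (suc ℓ) g≤h u w = sum-mono-≤ λ v → *-monoʳ-≤ (P u v) (walkSum-mono ℓ (λ cs → g≤h (col u v ∷ cs)) v w)

  walkSum-+ : ∀ ℓ g h u w → walkSum ℓ (λ cs → g cs + h cs) u w ≡ walkSum ℓ g u w + walkSum ℓ h u w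
  walkSum-+ zero    g h u w = *-distribˡ-+ (𝟙 u w) (g []) (h [])
  walkSum-+ (suc ℓ) g h u w = trans
    (sum-cong-≗ λ v → trans
      (cong (P u v *_) (walkSum-+ ℓ (λ cs → g (col u v ∷ cs)) (λ cs → h (col u v ∷ cs)) v w))
      (*-distribˡ-+ (P u v) _ _))
    (∑-distrib-+ (λ v → P u v * walkSum ℓ (λ cs → g (col u v ∷ cs)) v w)
                 (λ v → P u v * walkSum ℓ (λ cs → h (col u v ∷ cs)) v w))

  walkSum-const : ∀ ℓ a u w → walkSum ℓ (λ _ → a) u w ≡ a * (P ↑ ℓ) u w
  walkSum-const zero    a u w = *-comm (𝟙 u w) a
  walkSum-const (suc ℓ) a u w = trans
    (sum-cong-≗ λ v → trans (cong (P u v *_) (walkSum-const ℓ a v w)) (swap (P u v) a ((P ↑ ℓ) v w)))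
    (sym (*-distribˡ-sum a (λ v → P u v * (P ↑ ℓ) v w)))
    where swap : ∀ x y z → x * (y * z) ≡ y * (x * z)
          swap = solve-∀

  -- Nothing cancels in ℕ, so a positive sum has a positive summand; choosing one at every step
  -- traces out the walk.
  walkSum-witness : ∀ ℓ g u w → 0 < walkSum ℓ g u w →
    ∃[ x ] x 0 ≡ u × x ℓ ≡ w × (∀ i → i < ℓ → 0 < P (x i) (x (suc i))) × 0 < g (colours col x ℓ)
  walkSum-witness zero g u w pos with u Fin.≟ w
  ... | yes u≡w = (λ _ → u) , refl , u≡w , (λ _ ()) , subst (0 <_) (+-identityʳ (g [])) pos
  walkSum-witness (suc ℓ) g u w pos with sum-pos _ pos
  ... | v , pos′ with P u v in Puv | walkSum ℓ (λ cs → g (col u v ∷ cs)) v w in rest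
  ...   | zero  | _    = contradiction pos′ λ ()
  ...   | suc p | zero = contradiction (subst (0 <_) (*-zeroʳ p) pos′) λ ()
  ...   | suc p | suc _ with walkSum-witness ℓ _ v w (subst (0 <_) (sym rest) (s≤s z≤n))
  ...     | x , refl , xℓ , edges , g>0 = x′ , refl , xℓ , edges′ , g>0
    where
    x′ : ℕ → Fin n
    x′ zero    = u
    x′ (suc i) = x i
    edges′ : ∀ i → i < suc ℓ → 0 < P (x′ i) (x i)
    edges′ zero    _   = subst (0 <_) (sym Puv) (s≤s z≤n)
    edges′ (suc i) i<ℓ = edges i (s≤s⁻¹ i<ℓ)

  coloured : ℕ → Mat n
  coloured k u v = ⟦ k ≟ col u v ⟧ * P u v

  -- The counted occurrence of `k` is either the first step, after which the walk is arbitrary, or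
  -- lies among the other `ℓ` steps.
  walkSum-count : ∀ ℓ k u w → walkSum (suc ℓ) (count k) u w
                ≡ (coloured k ⊗ P ↑ ℓ) u w + (P ⊗ walkSum ℓ (count k)) u w
  walkSum-count ℓ k u w = trans
    (sum-cong-≗ λ v → trans
      (cong (P u v *_) (trans (walkSum-+ ℓ (λ _ → ⟦ k ≟ col u v ⟧) (count k) v w)
                              (cong (_+ walkSum ℓ (count k) v w) (walkSum-const ℓ ⟦ k ≟ col u v ⟧ v w))))
      (regroup (P u v) ⟦ k ≟ col u v ⟧ ((P ↑ ℓ) v w) (walkSum ℓ (count k) v w)))
    (∑-distrib-+ (λ v → coloured k u v * (P ↑ ℓ) v w) (λ v → P u v * walkSum ℓ (count k) v w))
    where regroup : ∀ p d q s → p * (d * q + s) ≡ d * p * q + p * s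
          regroup = solve-∀

  module _ {N : ℕ} (col<N : ∀ u v → col u v < N) where

    B : Fin N → Mat n
    B c = coloured (toℕ c)

    counts : ℕ → Fin N → Mat n
    counts ℓ c = walkSum ℓ (count (toℕ c))

    -- Either the pair contains the first step, of some colour `c`, and its partner is counted among
    -- the later steps, or both steps of the pair come later.
    walkSum-repeats : ∀ ℓ u w → walkSum (suc ℓ) repeats u w
                    ≡ ∑[ c < N ] (B c ⊗ counts ℓ c) u w + (P ⊗ walkSum ℓ repeats) u w
    walkSum-repeats ℓ u w = trans
      (sum-cong-≗ λ v → trans
        (cong (P u v *_) (walkSum-+ ℓ (count (col u v)) repeats v w))
        (*-distribˡ-+ (P u v) _ _))
      (trans (∑-distrib-+ (λ v → P u v * walkSum ℓ (count (col u v)) v w) (λ v → P u v * walkSum ℓ repeats v w))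
             (cong (_+ (P ⊗ walkSum ℓ repeats) u w) (begin
        ∑[ v < n ] (P u v * walkSum ℓ (count (col u v)) v w)
          ≡⟨ sum-cong-≗ (λ v → sum-⟦⟧-toℕ (λ k → P u v * walkSum ℓ (count k) v w) (col u v) (col<N u v)) ⟨
        ∑[ v < n ] ∑[ c < N ] (⟦ toℕ c ≟ col u v ⟧ * (P u v * counts ℓ c v w))
          ≡⟨ sum-cong-≗ (λ v → sum-cong-≗ {N} λ c → *-assoc ⟦ toℕ c ≟ col u v ⟧ (P u v) (counts ℓ c v w)) ⟨
        ∑[ v < n ] ∑[ c < N ] (B c u v * counts ℓ c v w)
          ≡⟨ ∑-comm (λ v c → B c u v * counts ℓ c v w) ⟩
        ∑[ c < N ] (B c ⊗ counts ℓ c) u w ∎)))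
      where open ≡-Reasoning

    open Repeat P B

    -- Closed walks made of `p` arbitrary steps, a step of colour `c`, `q` arbitrary steps and `ℓ`
    -- more, counted once for each of these `ℓ` that has colour `c` again.
    countTrace : ℕ → ℕ → ℕ → ℕ
    countTrace p q ℓ = ∑[ c < N ] tr ((P ↑ p ⊗ (B c ⊗ P ↑ q)) ⊗ counts ℓ c)

    countTrace-zero : ∀ p q → countTrace p q 0 ≡ 0
    countTrace-zero p q = sum-zero λ c → sum-zero λ u → sum-zero λ v →
      trans (cong (W c u v *_) (*-zeroʳ (𝟙 v u))) (*-zeroʳ (W c u v))
      where W = λ c → P ↑ p ⊗ (B c ⊗ P ↑ q)

    -- If the second marked step comes at once, the remaining `ℓ` steps join the initial `p` to form
    -- one arc; otherwise the arc of `q` steps grows by one.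
    countTrace-suc : ∀ p q ℓ → countTrace p q (suc ℓ) ≡ R (ℓ + p) q + countTrace p (suc q) ℓ
    countTrace-suc p q ℓ = trans
      (sum-cong-≗ λ c → begin
        tr (W c ⊗ counts (suc ℓ) c)
          ≡⟨ tr-cong (⊗-cong (≋-refl {x = W c}) (ext (walkSum-count ℓ (toℕ c)))) ⟩
        tr (W c ⊗ λ u v → (B c ⊗ P ↑ ℓ) u v + (P ⊗ counts ℓ c) u v)
          ≡⟨ tr-⊗-+ (W c) (B c ⊗ P ↑ ℓ) (P ⊗ counts ℓ c) ⟩
        tr (W c ⊗ (B c ⊗ P ↑ ℓ)) + tr (W c ⊗ (P ⊗ counts ℓ c))
          ≡⟨ cong₂ _+_ (first c) (second c) ⟩
        repeat (ℓ + p) q c + tr ((P ↑ p ⊗ (B c ⊗ P ↑ suc q)) ⊗ counts ℓ c) ∎)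
      (∑-distrib-+ (repeat (ℓ + p) q) (λ c → tr ((P ↑ p ⊗ (B c ⊗ P ↑ suc q)) ⊗ counts ℓ c)))
      where
      open ≡-Reasoning
      open ⊗ using (_⊜_; _⊙_)
      W : Fin N → Mat n
      W c = P ↑ p ⊗ (B c ⊗ P ↑ q)
      first : ∀ c → tr (W c ⊗ (B c ⊗ P ↑ ℓ)) ≡ repeat (ℓ + p) q c
      first c = begin
        tr (W c ⊗ (B c ⊗ P ↑ ℓ)) ≡⟨ tr-cong (⊗-cong (≋-refl {x = W c}) (≋-sym (⊗-identityˡ (B c ⊗ P ↑ ℓ)))) ⟩
        tr (W c ⊗ (P ↑ 0 ⊗ (B c ⊗ P ↑ ℓ))) ≡⟨ repeat-split p q ℓ 0 c ⟩
        repeat (ℓ + p) (q + 0) c ≡⟨ cong (λ z → repeat (ℓ + p) z c) (+-identityʳ q) ⟩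
        repeat (ℓ + p) q c ∎
      second : ∀ c → tr (W c ⊗ (P ⊗ counts ℓ c)) ≡ tr ((P ↑ p ⊗ (B c ⊗ P ↑ suc q)) ⊗ counts ℓ c)
      second c = tr-cong (≋-trans
        (⊗.solve 5 (λ a b q x y → (a ⊙ (b ⊙ q)) ⊙ (x ⊙ y) ⊜ (a ⊙ (b ⊙ (q ⊙ x))) ⊙ y) ≋-refl
          (P ↑ p) (B c) (P ↑ q) P (counts ℓ c))
        (⊗-cong (⊗-cong (≋-refl {x = P ↑ p}) (⊗-cong (≋-refl {x = B c}) (↑-comm P q))) ≋-refl))

    -- Separates the pairs whose first member is the step right after the initial `p` steps from
    -- those that begin later.
    repeatsTrace-suc : ∀ p ℓ → tr (P ↑ p ⊗ walkSum (suc ℓ) repeats)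
                     ≡ countTrace p 0 ℓ + tr (P ↑ suc p ⊗ walkSum ℓ repeats)
    repeatsTrace-suc p ℓ = begin
      tr (P ↑ p ⊗ walkSum (suc ℓ) repeats)
        ≡⟨ tr-cong (⊗-cong (≋-refl {x = P ↑ p}) (ext (walkSum-repeats ℓ))) ⟩
      tr (P ↑ p ⊗ λ u v → ∑[ c < N ] (B c ⊗ counts ℓ c) u v + (P ⊗ walkSum ℓ repeats) u v)
        ≡⟨ tr-⊗-+ (P ↑ p) (λ u v → ∑[ c < N ] (B c ⊗ counts ℓ c) u v) (P ⊗ walkSum ℓ repeats) ⟩
      tr (P ↑ p ⊗ λ u v → ∑[ c < N ] (B c ⊗ counts ℓ c) u v) + tr (P ↑ p ⊗ (P ⊗ walkSum ℓ repeats))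
        ≡⟨ cong₂ _+_ first second ⟩
      countTrace p 0 ℓ + tr (P ↑ suc p ⊗ walkSum ℓ repeats) ∎
      where
      open ≡-Reasoning
      first : tr (P ↑ p ⊗ λ u v → ∑[ c < N ] (B c ⊗ counts ℓ c) u v) ≡ countTrace p 0 ℓ
      first = trans (tr-⊗-∑ (P ↑ p) (λ c → B c ⊗ counts ℓ c))
        (sum-cong-≗ λ c → tr-cong (≋-trans (≋-sym (⊗-assoc (P ↑ p) (B c) (counts ℓ c)))
          (⊗-cong (⊗-cong (≋-refl {x = P ↑ p}) (≋-sym (⊗-identityʳ (B c)))) ≋-refl)))
      second : tr (P ↑ p ⊗ (P ⊗ walkSum ℓ repeats)) ≡ tr (P ↑ suc p ⊗ walkSum ℓ repeats)
      second = tr-cong (≋-trans (≋-sym (⊗-assoc (P ↑ p) P (walkSum ℓ repeats)))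
        (⊗-cong (↑-comm P p) ≋-refl))

    module _ {π : Fin n → ℕ} (π>0 : ∀ v → 0 < π v)
             (P-adj : Adjoint π P P) (B-adj : ∀ c → Adjoint π (B c) (B c))
             {δ K : ℕ} (square : ∀ u v → δ * (∑[ c < N ] (B c ⊗ B c) u v) ≤ K * 𝟙 u v) where

      -- When one arc is empty, the marked steps multiply to `B c ⊗ B c`, whose sum over `c` is
      -- controlled by `square`.
      R-zero : ∀ q → δ * R 0 q ≤ K * tr (P ↑ q)
      R-zero q = begin
        δ * R 0 q
          ≡⟨ cong (δ *_) (sum-cong-≗ λ c → trans
               (tr-comm (P ↑ 0 ⊗ B c) (P ↑ q ⊗ B c))
               (tr-cong (≋-trans (⊗-cong (≋-refl {x = P ↑ q ⊗ B c}) (⊗-identityˡ (B c)))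
                                 (⊗-assoc (P ↑ q) (B c) (B c))))) ⟩
        δ * (∑[ c < N ] tr (P ↑ q ⊗ (B c ⊗ B c)))
          ≡⟨ cong (δ *_) (tr-⊗-∑ (P ↑ q) (λ c → B c ⊗ B c)) ⟨
        δ * tr (P ↑ q ⊗ λ u v → ∑[ c < N ] (B c ⊗ B c) u v)
          ≡⟨ pull δ (P ↑ q) _ ⟩
        tr (P ↑ q ⊗ λ u v → δ * (∑[ c < N ] (B c ⊗ B c) u v))
          ≤⟨ sum-mono-≤ (λ u → sum-mono-≤ λ v → *-monoʳ-≤ ((P ↑ q) u v) (square v u)) ⟩
        tr (P ↑ q ⊗ λ u v → K * 𝟙 u v)
          ≡⟨ pull K (P ↑ q) 𝟙 ⟨
        K * tr (P ↑ q ⊗ 𝟙)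
          ≡⟨ cong (K *_) (tr-cong (⊗-identityʳ (P ↑ q))) ⟩
        K * tr (P ↑ q) ∎
        where
        open ≤-Reasoning
        swap : ∀ a x y → a * (x * y) ≡ x * (a * y)
        swap = solve-∀
        pull : ∀ a (X Y : Mat n) → a * tr (X ⊗ Y) ≡ tr (X ⊗ λ u v → a * Y u v)
        pull a X Y = trans (*-distribˡ-sum a (λ u → (X ⊗ Y) u u))
          (sum-cong-≗ λ u → trans (*-distribˡ-sum a (λ v → X u v * Y v u))
                                  (sum-cong-≗ λ v → swap a (X u v) (Y v u)))

      module _ (m : ℕ) where

        private T = K * tr (P ↑ (m + m))

        -- Each of the `ℓ` positions of the second marked step gives one term `R` with arcs of total
        -- length `m + m`; by `R-max` and `R-zero` it costs at most `T`.
        countTrace-≤ : ∀ ℓ p q → p + q + ℓ ≡ suc (m + m) → δ * countTrace p q ℓ ≤ ℓ * T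
        countTrace-≤ zero    p q _  = ≤-reflexive (trans (cong (δ *_) (countTrace-zero p q)) (*-zeroʳ δ))
        countTrace-≤ (suc ℓ) p q eq = begin
          δ * countTrace p q (suc ℓ)                   ≡⟨ cong (δ *_) (countTrace-suc p q ℓ) ⟩
          δ * (R (ℓ + p) q + countTrace p (suc q) ℓ)   ≡⟨ *-distribˡ-+ δ (R (ℓ + p) q) _ ⟩
          δ * R (ℓ + p) q + δ * countTrace p (suc q) ℓ ≤⟨ +-mono-≤ bound (countTrace-≤ ℓ p (suc q) (trans (lemma₁ p q ℓ) eq)) ⟩
          T + ℓ * T ∎
          where
          open ≤-Reasoning
          lemma₁ : ∀ p q ℓ → p + suc q + ℓ ≡ p + q + suc ℓ
          lemma₁ = solve-∀
          lemma₂ : ∀ p q ℓ → suc (ℓ + p + q) ≡ p + q + suc ℓ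
          lemma₂ = solve-∀
          bound : δ * R (ℓ + p) q ≤ T
          bound = ≤-trans
            (*-monoʳ-≤ δ (R-max π>0 P-adj B-adj m (ℓ + p) q (suc-injective (trans (lemma₂ p q ℓ) eq))))
            (R-zero (m + m))

        -- The walks have length `2m + 2`; each of the `ℓ` positions of the first marked step costs
        -- at most `2m + 1` times `T`.
        repeatsTrace-≤ : ∀ ℓ p → p + ℓ ≡ suc (suc (m + m)) →
                         δ * tr (P ↑ p ⊗ walkSum ℓ repeats) ≤ ℓ * (suc (m + m) * T)
        repeatsTrace-≤ zero    p _  = ≤-reflexive (trans (cong (δ *_) (sum-zero λ u → sum-zero λ v →
          trans (cong ((P ↑ p) u v *_) (*-zeroʳ (𝟙 v u))) (*-zeroʳ ((P ↑ p) u v)))) (*-zeroʳ δ))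
        repeatsTrace-≤ (suc ℓ) p eq = begin
          δ * tr (P ↑ p ⊗ walkSum (suc ℓ) repeats)
            ≡⟨ cong (δ *_) (repeatsTrace-suc p ℓ) ⟩
          δ * (countTrace p 0 ℓ + tr (P ↑ suc p ⊗ walkSum ℓ repeats))
            ≡⟨ *-distribˡ-+ δ (countTrace p 0 ℓ) _ ⟩
          δ * countTrace p 0 ℓ + δ * tr (P ↑ suc p ⊗ walkSum ℓ repeats)
            ≤⟨ +-mono-≤ (countTrace-≤ ℓ p 0 (trans (cong (_+ ℓ) (+-identityʳ p)) p+ℓ))
                        (repeatsTrace-≤ ℓ (suc p) (trans (sym (+-suc p ℓ)) eq)) ⟩
          -- The second marked step has only `ℓ` positions left. Allowing `2m + 1` each time
          -- overcounts the pairs by a factor of two in total.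
          ℓ * T + ℓ * (suc (m + m) * T)
            ≤⟨ +-monoˡ-≤ (ℓ * (suc (m + m) * T)) (*-monoˡ-≤ T (subst (ℓ ≤_) p+ℓ (m≤n+m ℓ p))) ⟩
          suc (m + m) * T + ℓ * (suc (m + m) * T) ∎
          where
          open ≤-Reasoning
          p+ℓ : p + ℓ ≡ suc (m + m)
          p+ℓ = suc-injective (trans (sym (+-suc p ℓ)) eq)

      1≤1∸r+r : ∀ r → 1 ≤ (1 ∸ r) + r
      1≤1∸r+r zero    = s≤s z≤n
      1≤1∸r+r (suc r) = subst (λ z → 1 ≤ z + suc r) (sym (0∸n≡0 r)) (s≤s z≤n)

      -- The weight `1 ∸ repeats cs` is the indicator of distinct colours. If its trace vanishes,
      -- every closed walk of positive weight has a repeat, and the number of repeats dominates the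
      -- trace; otherwise a walk can be extracted.
      trace-step : ∀ m → let ℓ = suc (suc (m + m)) in
        δ * tr (P ↑ ℓ) ≤ ℓ * (suc (m + m) * (K * tr (P ↑ (m + m))))
        ⊎ ∃[ x ] x ℓ ≡ x 0 × (∀ i → i < ℓ → 0 < P (x i) (x (suc i))) × repeats (colours col x ℓ) ≡ 0
      trace-step m with tr (walkSum (suc (suc (m + m))) (λ cs → 1 ∸ repeats cs)) in eq
      ... | zero = inj₁ (begin
        δ * tr (P ↑ ℓ)
          ≡⟨ cong (δ *_) (sum-cong-≗ λ u → trans (walkSum-const ℓ 1 u u) (*-identityˡ ((P ↑ ℓ) u u))) ⟨
        δ * tr (walkSum ℓ (λ _ → 1))
          ≤⟨ *-monoʳ-≤ δ (sum-mono-≤ λ u → walkSum-mono ℓ (1≤1∸r+r ∘ repeats) u u) ⟩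
        δ * tr (walkSum ℓ (λ cs → (1 ∸ repeats cs) + repeats cs))
          ≡⟨ cong (δ *_) (trans (sum-cong-≗ λ u → walkSum-+ ℓ (λ cs → 1 ∸ repeats cs) repeats u u)
                                (∑-distrib-+ (λ u → walkSum ℓ (λ cs → 1 ∸ repeats cs) u u) (λ u → walkSum ℓ repeats u u))) ⟩
        δ * (tr (walkSum ℓ (λ cs → 1 ∸ repeats cs)) + tr (walkSum ℓ repeats))
          ≡⟨ cong (λ z → δ * (z + tr (walkSum ℓ repeats))) eq ⟩
        δ * tr (walkSum ℓ repeats)
          ≡⟨ cong (δ *_) (tr-cong (⊗-identityˡ (walkSum ℓ repeats))) ⟨
        δ * tr (P ↑ 0 ⊗ walkSum ℓ repeats)
          ≤⟨ repeatsTrace-≤ m ℓ 0 refl ⟩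
        ℓ * (suc (m + m) * (K * tr (P ↑ (m + m)))) ∎)
        where open ≤-Reasoning
              ℓ = suc (suc (m + m))
      ... | suc _ with sum-pos _ (subst (0 <_) (sym eq) (s≤s z≤n))
      ...   | u , pos with walkSum-witness (suc (suc (m + m))) (λ cs → 1 ∸ repeats cs) u u pos
      ...     | x , x0≡u , xℓ≡u , edges , norep = inj₂ (x , trans xℓ≡u (sym x0≡u) , edges , zero-of norep)
        where zero-of : ∀ {r} → 0 < 1 ∸ r → r ≡ 0
              zero-of {zero} _ = refl
              zero-of {suc r} p = contradiction (subst (0 <_) (0∸n≡0 r) p) λ ()

-- From closed rainbow walks to rainbow cycles

module _ {n : ℕ} (col : Fin n → Fin n → ℕ) where

  count≡0 : ∀ k x ℓ → count k (colours col x ℓ) ≡ 0 → ∀ i → i < ℓ → k ≢ col (x i) (x (suc i))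
  count≡0 k x (suc ℓ) none zero    _   k≡ = contradiction
    (trans (sym (⟦⟧-yes (k ≟ col (x 0) (x 1)) k≡)) (m+n≡0⇒m≡0 _ none)) λ ()
  count≡0 k x (suc ℓ) none (suc i) i<ℓ = count≡0 k (x ∘ suc) ℓ (m+n≡0⇒n≡0 ⟦ k ≟ col (x 0) (x 1) ⟧ none) i (s≤s⁻¹ i<ℓ)

  repeats≡0 : ∀ x ℓ → repeats (colours col x ℓ) ≡ 0 →
              ∀ i j → i < j → j < ℓ → col (x i) (x (suc i)) ≢ col (x j) (x (suc j))
  repeats≡0 x (suc ℓ) none zero    (suc j) _   j<ℓ =
    count≡0 _ (x ∘ suc) ℓ (m+n≡0⇒m≡0 _ none) j (s≤s⁻¹ j<ℓ)
  repeats≡0 x (suc ℓ) none (suc i) (suc j) i<j j<ℓ =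
    repeats≡0 (x ∘ suc) ℓ (m+n≡0⇒n≡0 (count (col (x 0) (x 1)) (colours col (x ∘ suc) ℓ)) none) i j (s≤s⁻¹ i<j) (s≤s⁻¹ j<ℓ)

-- `next` wraps the last index to 0, where a closed walk has the same value as at `suc k`.
lookup-next : ∀ {A : Set} {k} (x : ℕ → A) → x (suc k) ≡ x 0 → (i : Fin (suc k)) → x (toℕ (next i)) ≡ x (suc (toℕ i))
lookup-next {k = k} x closed i = trans (cong x (Fin.toℕ-fromℕ< (m%n<n (suc (toℕ i)) (suc k)))) (wrap (m≤n⇒m<n∨m≡n (Fin.toℕ<n i)))
  where
  wrap : suc (toℕ i) < suc k ⊎ suc (toℕ i) ≡ suc k → x (suc (toℕ i) % suc k) ≡ x (suc (toℕ i))
  wrap (inj₁ i<k) = cong x (m<n⇒m%n≡m i<k)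
  wrap (inj₂ i≡k) = trans (cong x (trans (cong (_% suc k) i≡k) (n%n≡0 (suc k))))
                          (trans (sym closed) (cong x (sym i≡k)))

module _ {n : ℕ} (G : Graph n) (c : ProperEdgeColouring G) where

  -- A repeated vertex splits off a shorter closed rainbow walk.
  closed-rainbow-walk⇒cycle : ∀ ℓ (x : ℕ → Fin n) → 0 < ℓ → x ℓ ≡ x 0 →
    (∀ i → i < ℓ → Adj G (x i) (x (suc i))) →
    (∀ i j → i < j → j < ℓ → col c (x i) (x (suc i)) ≢ col c (x j) (x (suc j))) →
    RainbowCycle G c
  closed-rainbow-walk⇒cycle = <-rec _ go
    where
    Goal : ℕ → Set
    Goal ℓ = ∀ (x : ℕ → Fin n) → 0 < ℓ → x ℓ ≡ x 0 →
      (∀ i → i < ℓ → Adj G (x i) (x (suc i))) →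
      (∀ i j → i < j → j < ℓ → col c (x i) (x (suc i)) ≢ col c (x j) (x (suc j))) →
      RainbowCycle G c
    go : ∀ ℓ → (∀ {ℓ′} → ℓ′ < ℓ → Goal ℓ′) → Goal ℓ
    go 1 rec x _ closed edges distinct =
      contradiction (subst (Adj G (x 0)) closed (edges 0 ≤-refl)) (irrfl G)
    -- A closed walk of length 2 runs along one edge and back, repeating its colour.
    go 2 rec x _ closed edges distinct =
      contradiction (trans (col-sym c (edges 0 (s≤s z≤n))) (cong (col c (x 1)) (sym closed)))
                    (distinct 0 1 ≤-refl ≤-refl)
    go (suc (suc (suc k))) rec x _ closed edges distinct
      with Fin.any? (λ i → Fin.any? (λ (j : Fin (3 + k)) → (toℕ i <? toℕ j) ×-dec (x (toℕ i) Fin.≟ x (toℕ j))))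
    ... | yes (i , j , i<j , xi≡xj) with m≤n⇒∃[o]m+o≡n i<j
    ...   | d , eq = rec d<ℓ (λ t → x (t + toℕ i)) (s≤s z≤n)
                       (trans (cong x (sym j≡)) (sym xi≡xj))
                       (λ t t<d → edges (t + toℕ i) (shift t<d))
                       (λ s t s<t t<d → distinct (s + toℕ i) (t + toℕ i) (+-monoˡ-< (toℕ i) s<t) (shift t<d))
      where
      j≡ : toℕ j ≡ suc d + toℕ i
      j≡ = trans (sym eq) (cong suc (+-comm (toℕ i) d))
      j<ℓ : toℕ j < 3 + k
      j<ℓ = Fin.toℕ<n j
      d<ℓ : suc d < 3 + k
      d<ℓ = ≤-<-trans (≤-trans (m≤m+n (suc d) (toℕ i)) (≤-reflexive (sym j≡))) j<ℓ
      shift : ∀ {t} → t < suc d → t + toℕ i < 3 + k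
      shift t<d = <-trans (<-≤-trans (+-monoˡ-< (toℕ i) t<d) (≤-reflexive (sym j≡))) j<ℓ
    go (suc (suc (suc k))) rec x _ closed edges distinct | no none = record
      { k = k
      ; vtx = x ∘ toℕ
      ; vtx-inj = injective (x ∘ toℕ) λ i j i<j eq → none (i , j , i<j , eq)
      ; edges = λ i → subst (Adj G (x (toℕ i))) (sym (lookup-next x closed i)) (edges (toℕ i) (Fin.toℕ<n i))
      ; rainbow = injective _ λ i j i<j eq → distinct (toℕ i) (toℕ j) i<j (Fin.toℕ<n j)
          (trans (cong (col c (x (toℕ i))) (sym (lookup-next x closed i)))
                 (trans eq (cong (col c (x (toℕ j))) (lookup-next x closed j))))
      }
      where
      injective : ∀ {A : Set} (f : Fin (3 + k) → A) → (∀ i j → toℕ i < toℕ j → f i ≢ f j) →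
                  ∀ {i j} → f i ≡ f j → i ≡ j
      injective f f-inj {i} {j} eq with <-cmp (toℕ i) (toℕ j)
      ... | tri< i<j _ _ = contradiction eq (f-inj i j i<j)
      ... | tri≈ _ i≡j _ = Fin.toℕ-injective i≡j
      ... | tri> _ _ j<i = contradiction (sym eq) (f-inj j i j<i)

-- Lower bound for the trace from an eigenvector

_·_ : ∀ {n} → ℕ → Mat n → Mat n
(a · X) u v = a * X u v

·-adjoint : ∀ {n} {π : Fin n → ℕ} {X Y} a → Adjoint π X Y → Adjoint π (a · X) (a · Y)
·-adjoint {π = π} {X} {Y} a p = adj λ u v →
  trans (swap (π u) a (X u v)) (trans (cong (a *_) (rev p u v)) (sym (swap (π v) a (Y v u))))
  where swap : ∀ x a y → x * (a * y) ≡ a * (x * y)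
        swap = solve-∀

tr-· : ∀ {n} a b (X Y : Mat n) → tr ((a · X) ⊗ (b · Y)) ≡ a * b * tr (X ⊗ Y)
tr-· {n} a b X Y = trans
  (sum-cong-≗ λ u → trans (sum-cong-≗ λ v → regroup a b (X u v) (Y v u))
                          (sym (*-distribˡ-sum (a * b) (λ v → X u v * Y v u))))
  (sym (*-distribˡ-sum (a * b) (λ u → (X ⊗ Y) u u)))
  where regroup : ∀ a b x y → a * x * (b * y) ≡ a * b * (x * y)
        regroup = solve-∀

module _ {n : ℕ} {P : Mat n} {π d : Fin n → ℕ} {L : ℕ} (π>0 : ∀ v → 0 < π v) (P-adj : Adjoint π P P)
         (πd : ∀ v → π v * d v ≡ L) (eigen : ∀ u → ∑[ v < n ] (P u v * d v) ≡ L * d u) where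

  private
    -- All columns are the eigenvector `d`; divided by `E`, this is the orthogonal projection onto
    -- `d`.
    D : Mat n
    D u v = d u

    E = sum d

  eigen-↑ : ∀ k u v → (P ↑ k ⊗ D) u v ≡ L ^ k * d u
  eigen-↑ zero    u v = trans (at (⊗-identityˡ D) u v) (sym (+-identityʳ (d u)))
  eigen-↑ (suc k) u v = begin
    ((P ⊗ P ↑ k) ⊗ D) u v                ≡⟨ at (⊗-assoc P (P ↑ k) D) u v ⟩
    ∑[ w < n ] (P u w * (P ↑ k ⊗ D) w v)  ≡⟨ sum-cong-≗ (λ w → trans (cong (P u w *_) (eigen-↑ k w v)) (swap (P u w) (L ^ k) (d w))) ⟩
    ∑[ w < n ] (L ^ k * (P u w * d w))    ≡⟨ *-distribˡ-sum (L ^ k) (λ w → P u w * d w) ⟨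
    L ^ k * (∑[ w < n ] (P u w * d w))    ≡⟨ cong (L ^ k *_) (eigen u) ⟩
    L ^ k * (L * d u)                     ≡⟨ regroup (L ^ k) L (d u) ⟩
    L ^ suc k * d u ∎
    where
    open ≡-Reasoning
    swap : ∀ x a y → x * (a * y) ≡ a * (x * y)
    swap = solve-∀
    regroup : ∀ m l x → m * (l * x) ≡ l * m * x
    regroup = solve-∀

  -- With `Q = P ↑ k` and `M = L ^ k`, this is `tr ((Q - M D / E)²) ≥ 0` multiplied by `E * E`. The
  -- cross terms are known because `Q` multiplies `d` by `M`.
  trace-≥ : 0 < E → ∀ k → L ^ k * L ^ k ≤ tr (P ↑ (k + k))
  trace-≥ 0<E k = *-cancelˡ-≤ (E * E) {{>-nonZero (*-mono-≤ 0<E 0<E)}}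
    (+-cancelʳ-≤ (E * E * (M * M)) _ _ (begin
      E * E * (M * M) + E * E * (M * M)
        ≡⟨ arith E M ⟩
      E * M * (M * E) + M * E * (M * E)
        ≡⟨ cong₂ (λ s t → E * M * s + M * E * t) trQD (trans (tr-comm D Q) trQD) ⟨
      E * M * tr (Q ⊗ D) + M * E * tr (D ⊗ Q)
        ≡⟨ cong₂ _+_ (tr-· E M Q D) (tr-· M E D Q) ⟨
      tr ((E · Q) ⊗ (M · D)) + tr ((M · D) ⊗ (E · Q))
        ≤⟨ tr-amgm π>0 (·-adjoint E Q-adj) (·-adjoint M D-adj) ⟩
      tr ((E · Q) ⊗ (E · Q)) + tr ((M · D) ⊗ (M · D))
        ≡⟨ cong₂ _+_ (tr-· E E Q Q) (tr-· M M D D) ⟩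
      E * E * tr (Q ⊗ Q) + M * M * tr (D ⊗ D)
        ≡⟨ cong₂ _+_ (cong (E * E *_) (tr-cong (↑-+ P k k))) (trans (cong (M * M *_) trDD) (*-comm (M * M) (E * E))) ⟩
      E * E * tr (P ↑ (k + k)) + E * E * (M * M) ∎))
    where
    open ≤-Reasoning
    M = L ^ k
    Q = P ↑ k
    arith : ∀ e m → e * e * (m * m) + e * e * (m * m) ≡ e * m * (m * e) + m * e * (m * e)
    arith = solve-∀
    Q-adj : Adjoint π Q Q
    Q-adj = ↑-adjoint P-adj k
    D-adj : Adjoint π D D
    D-adj = adj λ u v → trans (πd u) (sym (πd v))
    trQD : tr (Q ⊗ D) ≡ M * E
    trQD = trans (sum-cong-≗ λ u → eigen-↑ k u u) (sym (*-distribˡ-sum M d))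
    trDD : tr (D ⊗ D) ≡ E * E
    trDD = trans (sum-cong-≗ λ u → sym (*-distribˡ-sum (d u) d)) (sym (*-distribʳ-sum E d))

-- The random walk on a graph of given minimum degree

∏-pos : ∀ {n} (f : Fin n → ℕ) → (∀ i → 0 < f i) → 0 < ∏.sum f
∏-pos {zero}  f f>0 = s≤s z≤n
∏-pos {suc n} f f>0 = *-mono-≤ (f>0 zero) (∏-pos (f ∘ suc) (f>0 ∘ suc))

term≤sum : ∀ {n} (f : Fin n → ℕ) i → f i ≤ sum f
term≤sum f zero    = m≤m+n _ _
term≤sum f (suc i) = m≤n⇒m≤o+n (f zero) (term≤sum (f ∘ suc) i)

sum-ones : ∀ n → sum {n} (λ _ → 1) ≡ n
sum-ones zero    = refl
sum-ones (suc n) = cong suc (sum-ones n)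

adjacency : ∀ {n} → Graph n → Mat n
adjacency G u v = ⟦ adj? G u v ⟧

adjacency-sym : ∀ {n} (G : Graph n) u v → adjacency G u v ≡ adjacency G v u
adjacency-sym G u v with adj? G u v
... | yes p = sym (⟦⟧-yes (adj? G v u) (Adj-sym G p))
... | no ¬p = sym (⟦⟧-no (adj? G v u) (¬p ∘ Adj-sym G))

adjacency≤1 : ∀ {n} (G : Graph n) u v → adjacency G u v ≤ 1
adjacency≤1 G u v with adj? G u v
... | yes _ = ≤-refl
... | no  _ = z≤n

degree : ∀ {n} → Graph n → Fin n → ℕ
degree {n} G u = ∑[ v < n ] adjacency G u v

module MinDegree {n : ℕ} (G : Graph (suc n)) (c : ProperEdgeColouring G)
                 (δ : ℕ) (δ>0 : 0 < δ) (δ≤deg : ∀ v → δ ≤ degree G v) where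

  private
    V = suc n
    deg = degree G

  deg>0 : ∀ v → 0 < deg v
  deg>0 v = ≤-trans δ>0 (δ≤deg v)

  L : ℕ
  L = ∏.sum deg

  -- L / deg v, kept integral.
  π : Fin V → ℕ
  π v = ∏.sum (deg ∘ punchIn v)

  π>0 : ∀ v → 0 < π v
  π>0 v = ∏-pos (deg ∘ punchIn v) (deg>0 ∘ punchIn v)

  πdeg : ∀ v → π v * deg v ≡ L
  πdeg v = trans (*-comm (π v) (deg v)) (sym (∏.sum-remove {i = v} deg))

  L>0 : 0 < L
  L>0 = ∏-pos deg deg>0

  -- The sum of all values of `col` is a crude bound for each of them; it makes the range of colours
  -- finite.
  N : ℕ
  N = suc (∑[ u < V ] ∑[ v < V ] col c u v)

  col<N : ∀ u v → col c u v < N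
  col<N u v = s≤s (≤-trans (term≤sum (col c u) v) (term≤sum (λ u → sum (col c u)) u))

  -- `L` times the transpose of the random walk matrix: each step carries the weight of the vertex
  -- that it enters. The degrees then form a right eigenvector with eigenvalue `L`.
  P : Mat V
  P u v = adjacency G u v * π v

  open Walks P (col c)

  P-adj : Adjoint π P P
  P-adj = adj λ u v → trans (cong (λ a → π u * (a * π v)) (adjacency-sym G u v)) (swap (π u) (adjacency G v u) (π v))
    where swap : ∀ x a y → x * (a * y) ≡ y * (a * x)
          swap = solve-∀

  P>0⇒Adj : ∀ u v → 0 < P u v → Adj G u v
  P>0⇒Adj u v P>0 with adj? G u v
  ... | yes p = p

  coloured-adj : ∀ k → Adjoint π (coloured k) (coloured k)
  coloured-adj k = adj λ u v → go u v
    where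
    swap : ∀ x d a y → x * (d * (a * y)) ≡ y * (d * (a * x))
    swap = solve-∀
    go : ∀ u v → π u * coloured k u v ≡ π v * coloured k v u
    go u v with adj? G u v | adj? G v u
    ... | yes p | yes q = trans (cong (λ l → π u * (⟦ k ≟ l ⟧ * (1 * π v))) (col-sym c p))
                                (swap (π u) ⟦ k ≟ col c v u ⟧ 1 (π v))
    ... | yes p | no ¬q = contradiction (Adj-sym G p) ¬q
    ... | no ¬p | yes q = contradiction (Adj-sym G q) ¬p
    ... | no ¬p | no ¬q = trans (vanish (π u) ⟦ k ≟ col c u v ⟧) (sym (vanish (π v) ⟦ k ≟ col c v u ⟧))
      where vanish : ∀ x d → x * (d * 0) ≡ 0
            vanish = solve-∀

  eigen : ∀ u → ∑[ v < V ] (P u v * deg v) ≡ L * deg u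
  eigen u = begin
    ∑[ v < V ] (adjacency G u v * π v * deg v)
      ≡⟨ sum-cong-≗ (λ v → trans (*-assoc (adjacency G u v) (π v) (deg v)) (trans (cong (adjacency G u v *_) (πdeg v)) (*-comm (adjacency G u v) L))) ⟩
    ∑[ v < V ] (L * adjacency G u v) ≡⟨ *-distribˡ-sum L (adjacency G u) ⟨
    L * deg u ∎
    where open ≡-Reasoning

  -- In a proper colouring at most one edge at `v` has colour `k`, so two steps of colour `k`
  -- through `v` return to their start.
  square-≢ : ∀ {u w} → u ≢ w → ∀ k v → coloured k u v * coloured k v w ≡ 0
  square-≢ {u} {w} u≢w k v with k ≟ col c u v | k ≟ col c v w | adj? G u v | adj? G v w
  ... | no _    | _      | _     | _     = refl
  ... | yes _   | _      | no _  | _     = refl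
  ... | yes _   | no _   | yes _ | _     = *-zeroʳ (1 * (1 * π v))
  ... | yes _   | yes _  | yes _ | no _  = *-zeroʳ (1 * (1 * π v))
  ... | yes k≡  | yes k≡′ | yes p | yes q = contradiction
    (trans (sym (col-sym c p)) (trans (sym k≡) k≡′)) (proper c (Adj-sym G p) q u≢w)

  -- Going to a neighbour `v` and back has weight `π v * π u`, for one colour only. As `π v * δ` is
  -- at most `π v * deg v`, which is `L`, summing over the `deg u` neighbours gives
  -- `L * π u * deg u`.
  square-≡ : ∀ u → δ * (∑[ k < N ] (B col<N k ⊗ B col<N k) u u) ≤ L * L
  square-≡ u = begin
    δ * (∑[ k < N ] ∑[ v < V ] (coloured (toℕ k) u v * coloured (toℕ k) v u))
      ≡⟨ cong (δ *_) (∑-comm {N} {V} (λ k v → coloured (toℕ k) u v * coloured (toℕ k) v u)) ⟩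
    δ * (∑[ v < V ] ∑[ k < N ] (coloured (toℕ k) u v * coloured (toℕ k) v u))
      ≤⟨ *-monoʳ-≤ δ (sum-mono-≤ λ v → sum-mono-≤ {N} λ k → drop ⟦ toℕ k ≟ col c u v ⟧ (P u v) (toℕ k ≟ col c v u) (P v u)) ⟩
    δ * (∑[ v < V ] ∑[ k < N ] (⟦ toℕ k ≟ col c u v ⟧ * (P u v * P v u)))
      ≡⟨ cong (δ *_) (sum-cong-≗ λ v → sum-⟦⟧-toℕ (λ _ → P u v * P v u) (col c u v) (col<N u v)) ⟩
    δ * (∑[ v < V ] (P u v * P v u))
      ≡⟨ *-distribˡ-sum δ (λ v → P u v * P v u) ⟩
    ∑[ v < V ] (δ * (P u v * P v u))
      ≤⟨ sum-mono-≤ bound ⟩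
    ∑[ v < V ] (L * π u * adjacency G u v)
      ≡⟨ *-distribˡ-sum (L * π u) (adjacency G u) ⟨
    L * π u * deg u
      ≡⟨ trans (*-assoc L (π u) (deg u)) (cong (L *_) (πdeg u)) ⟩
    L * L ∎
    where
    open ≤-Reasoning
    drop : ∀ d p {Q : Set} (e : Dec Q) q → d * p * (⟦ e ⟧ * q) ≤ d * (p * q)
    drop d p (yes _) q = ≤-reflexive (trans (cong (d * p *_) (*-identityˡ q)) (*-assoc d p q))
    drop d p (no _)  q = ≤-trans (≤-reflexive (*-zeroʳ (d * p))) z≤n
    regroup₁ : ∀ d a b x y → d * (a * x * (b * y)) ≡ b * (a * (x * d * y))
    regroup₁ = solve-∀
    regroup₂ : ∀ a l y → 1 * (a * (l * y)) ≡ l * y * a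
    regroup₂ = solve-∀
    bound : ∀ v → δ * (P u v * P v u) ≤ L * π u * adjacency G u v
    bound v = begin
      δ * (adjacency G u v * π v * (adjacency G v u * π u)) ≡⟨ regroup₁ δ (adjacency G u v) (adjacency G v u) (π v) (π u) ⟩
      adjacency G v u * (adjacency G u v * (π v * δ * π u))
        ≤⟨ *-mono-≤ (adjacency≤1 G v u) (*-monoʳ-≤ (adjacency G u v) (*-monoˡ-≤ (π u)
             (≤-trans (*-monoʳ-≤ (π v) (δ≤deg v)) (≤-reflexive (πdeg v))))) ⟩
      1 * (adjacency G u v * (L * π u)) ≡⟨ regroup₂ (adjacency G u v) L (π u) ⟩
      L * π u * adjacency G u v ∎

  square : ∀ u w → δ * (∑[ k < N ] (B col<N k ⊗ B col<N k) u w) ≤ L * L * 𝟙 u w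
  square u w with u Fin.≟ w
  ... | yes refl = ≤-trans (square-≡ u) (≤-reflexive (sym (*-identityʳ (L * L))))
  ... | no  u≢w  = ≤-trans (≤-reflexive (trans
    (cong (δ *_) (sum-zero {N} λ k → sum-zero λ v → square-≢ u≢w (toℕ k) v)) (*-zeroʳ δ))) z≤n

  -- Iterates `trace-step` from the trace `V` of the identity. `C` bounds all the factors
  -- `(2m + 2)(2m + 1)` at once, and the two additional steps contribute `L * L` through the
  -- scaling.
  cycle-or-trace-≤ : ∀ C k → (∀ m → m < k → suc (suc (m + m)) * suc (m + m) ≤ C) → ∀ m → m ≤ k →
    RainbowCycle G c ⊎ δ ^ m * tr (P ↑ (m + m)) ≤ C ^ m * (L ^ m * L ^ m * V)
  cycle-or-trace-≤ C k ≤C zero    _ = inj₂ (≤-reflexive (cong (_+ 0) (trans tr𝟙 (sym (+-identityʳ V)))))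
    where tr𝟙 : tr (𝟙 {V}) ≡ V
          tr𝟙 = trans (sum-cong-≗ {V} λ i → ⟦⟧-yes (i Fin.≟ i) refl) (sum-ones V)
  cycle-or-trace-≤ C k ≤C (suc m) m<k with cycle-or-trace-≤ C k ≤C m (<⇒≤ m<k)
  ... | inj₁ cycle = inj₁ cycle
  ... | inj₂ ih with trace-step col<N π>0 P-adj (λ k → coloured-adj (toℕ k)) {δ} {L * L} square m
  ...   | inj₂ (x , closed , edges , distinct) = inj₁ (closed-rainbow-walk⇒cycle G c (suc (suc (m + m))) x (s≤s z≤n) closed
            (λ i i<ℓ → P>0⇒Adj (x i) (x (suc i)) (edges i i<ℓ))
            (repeats≡0 (col c) x (suc (suc (m + m))) distinct))
  ...   | inj₁ step = inj₂ (begin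
    δ ^ suc m * tr (P ↑ (suc m + suc m))
      ≡⟨ cong (λ z → δ ^ suc m * tr (P ↑ suc z)) (+-suc m m) ⟩
    δ ^ suc m * tr (P ↑ ℓ)
      ≡⟨ regroup₁ δ (δ ^ m) (tr (P ↑ ℓ)) ⟩
    δ ^ m * (δ * tr (P ↑ ℓ))
      ≤⟨ *-monoʳ-≤ (δ ^ m) step ⟩
    δ ^ m * (ℓ * (suc (m + m) * (L * L * tr (P ↑ (m + m)))))
      ≡⟨ regroup₂ (δ ^ m) ℓ (suc (m + m)) (L * L) (tr (P ↑ (m + m))) ⟩
    ℓ * suc (m + m) * (L * L) * (δ ^ m * tr (P ↑ (m + m)))
      ≤⟨ *-mono-≤ (*-monoˡ-≤ (L * L) (≤C m m<k)) ih ⟩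
    C * (L * L) * (C ^ m * (L ^ m * L ^ m * V))
      ≡⟨ regroup₃ C L (C ^ m) (L ^ m) V ⟩
    C ^ suc m * (L ^ suc m * L ^ suc m * V) ∎)
    where
    open ≤-Reasoning
    ℓ = suc (suc (m + m))
    regroup₁ : ∀ d e t → d * e * t ≡ e * (d * t)
    regroup₁ = solve-∀
    regroup₂ : ∀ e x y l t → e * (x * (y * (l * t))) ≡ x * y * l * (e * t)
    regroup₂ = solve-∀
    regroup₃ : ∀ c l d m v → c * (l * l) * (d * (m * m * v)) ≡ c * d * (l * m * (l * m) * v)
    regroup₃ = solve-∀

  -- Compares the upper bound for the trace with `trace-≥` and cancels the scaling factor
  -- `L ^ k * L ^ k`.
  cycle-or-power-≤ : ∀ C k → (∀ m → m < k → suc (suc (m + m)) * suc (m + m) ≤ C) →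
    RainbowCycle G c ⊎ δ ^ k ≤ C ^ k * V
  cycle-or-power-≤ C k ≤C with cycle-or-trace-≤ C k ≤C k ≤-refl
  ... | inj₁ cycle = inj₁ cycle
  ... | inj₂ upper = inj₂ (*-cancelʳ-≤ _ _ (M * M) {{>-nonZero (*-mono-≤ M>0 M>0)}} (begin
    δ ^ k * (M * M)        ≤⟨ *-monoʳ-≤ (δ ^ k) (trace-≥ π>0 P-adj πdeg eigen 0<E k) ⟩
    δ ^ k * tr (P ↑ (k + k)) ≤⟨ upper ⟩
    C ^ k * (M * M * V)    ≡⟨ cong (C ^ k *_) (*-comm (M * M) V) ⟩
    C ^ k * (V * (M * M))  ≡⟨ *-assoc (C ^ k) V (M * M) ⟨
    C ^ k * V * (M * M)    ∎))
    where
    open ≤-Reasoning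
    M = L ^ k
    M>0 : 0 < M
    M>0 = m^n>0 L {{>-nonZero L>0}} k
    0<E : 0 < sum deg
    0<E = ≤-trans (deg>0 zero) (term≤sum deg zero)

-- Choice of the walk length

^-distribʳ-* : ∀ k x y → (x * y) ^ k ≡ x ^ k * y ^ k
^-distribʳ-* zero    x y = refl
^-distribʳ-* (suc k) x y = trans (cong (x * y *_) (^-distribʳ-* k x y)) (interchange x y (x ^ k) (y ^ k))
  where interchange : ∀ x y a b → x * y * (a * b) ≡ x * a * (y * b)
        interchange = solve-∀

-- With `K = suc k`, all factors `(2m + 2)(2m + 1)` for `m < K` are at most `C = (2K)²`. For
-- `δ = 2C`, a graph without a rainbow cycle would satisfy `(2C)^K ≤ C^K * suc n`, hence
-- `2^K ≤ suc n`.
min-degree⇒cycle : ∀ {n} (G : Graph (suc n)) (c : ProperEdgeColouring G) k → suc n < 2 ^ suc k →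
  (∀ v → 2 * ((suc k + suc k) * (suc k + suc k)) ≤ degree G v) → RainbowCycle G c
min-degree⇒cycle {n} G c k n<2^k ≤deg with MinDegree.cycle-or-power-≤ G c (2 * C) (s≤s z≤n) ≤deg C K ≤C
  where
  K = suc k
  C = (K + K) * (K + K)
  ≤C : ∀ m → m < K → suc (suc (m + m)) * suc (m + m) ≤ C
  ≤C m m<K = *-mono-≤ ≤2K (≤-trans (n≤1+n _) ≤2K)
    where ≤2K : suc (suc (m + m)) ≤ K + K
          ≤2K = ≤-trans (≤-reflexive (cong suc (sym (+-suc m m)))) (+-mono-≤ m<K m<K)
... | inj₁ cycle = cycle
... | inj₂ small = contradiction n<2^k (≤⇒≯ (*-cancelˡ-≤ (C ^ K) {{m^n≢0 C K}} (begin
  C ^ K * 2 ^ K ≡⟨ *-comm (C ^ K) (2 ^ K) ⟩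
  2 ^ K * C ^ K ≡⟨ ^-distribʳ-* K 2 C ⟨
  (2 * C) ^ K   ≤⟨ small ⟩
  C ^ K * suc n ∎)))
  where
  open ≤-Reasoning
  K = suc k
  C = (K + K) * (K + K)

-- Deleting vertices of small degree

delete : ∀ {n} → Graph (suc n) → Fin (suc n) → Graph n
delete G x = record
  { Adj   = λ u v → Adj G (punchIn x u) (punchIn x v)
  ; adj?  = λ u v → adj? G (punchIn x u) (punchIn x v)
  ; sym   = Adj-sym G
  ; irrfl = irrfl G
  }

delete-colouring : ∀ {n} {G : Graph (suc n)} → ProperEdgeColouring G → ∀ x → ProperEdgeColouring (delete G x)
delete-colouring c x = record
  { col     = λ u v → col c (punchIn x u) (punchIn x v)
  ; col-sym = col-sym c
  ; proper  = λ uv uw v≢w → proper c uv uw (v≢w ∘ Fin.punchIn-injective x _ _)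
  }

delete-cycle : ∀ {n} {G : Graph (suc n)} {c : ProperEdgeColouring G} x →
               RainbowCycle (delete G x) (delete-colouring c x) → RainbowCycle G c
delete-cycle x C = record
  { k       = RainbowCycle.k C
  ; vtx     = punchIn x ∘ RainbowCycle.vtx C
  ; vtx-inj = RainbowCycle.vtx-inj C ∘ Fin.punchIn-injective x _ _
  ; edges   = RainbowCycle.edges C
  ; rainbow = RainbowCycle.rainbow C
  }

degreeSum : ∀ {n} → Graph n → ℕ
degreeSum {n} G = ∑[ u < n ] degree G u

-- The adjacency matrix loses one row and one column, each of total at most `degree G x`.
degreeSum-delete : ∀ {n} (G : Graph (suc n)) x →
                   degreeSum G ≤ degree G x + degree G x + degreeSum (delete G x)
degreeSum-delete {n} G x = begin
  degreeSum G
    ≡⟨ ∑.sum-remove {i = x} (degree G) ⟩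
  degree G x + ∑[ u < n ] degree G (punchIn x u)
    ≡⟨ cong (degree G x +_) (trans (sum-cong-≗ λ u → ∑.sum-remove {i = x} (adjacency G (punchIn x u)))
                                   (∑-distrib-+ (λ u → adjacency G (punchIn x u) x) (degree (delete G x)))) ⟩
  degree G x + (∑[ u < n ] adjacency G (punchIn x u) x + degreeSum (delete G x))
    ≤⟨ +-monoʳ-≤ (degree G x) (+-monoˡ-≤ (degreeSum (delete G x)) column) ⟩
  degree G x + (degree G x + degreeSum (delete G x))
    ≡⟨ +-assoc (degree G x) (degree G x) _ ⟨
  degree G x + degree G x + degreeSum (delete G x) ∎
  where
  open ≤-Reasoning
  column : ∑[ u < n ] adjacency G (punchIn x u) x ≤ degree G x
  column = begin
    ∑[ u < n ] adjacency G (punchIn x u) x ≡⟨ sum-cong-≗ (λ u → adjacency-sym G (punchIn x u) x) ⟩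
    ∑[ u < n ] adjacency G x (punchIn x u) ≤⟨ m≤n+m _ (adjacency G x x) ⟩
    adjacency G x x + ∑[ u < n ] adjacency G x (punchIn x u) ≡⟨ ∑.sum-remove {i = x} (adjacency G x) ⟨
    degree G x ∎

-- Deleting a vertex of degree below `D` lowers the threshold by `D + D` and the degree sum by no
-- more, so the strict inequality persists while `k` stays fixed. It fails for the empty graph, so
-- deletion stops earlier, at minimum degree at least `D`.
dense⇒cycle : ∀ k n (G : Graph n) (c : ProperEdgeColouring G) → n < 2 ^ suc k →
  (let D = 2 * ((suc k + suc k) * (suc k + suc k)) in n * (D + D) < degreeSum G) → RainbowCycle G c
dense⇒cycle k zero    G c _   ()
dense⇒cycle k (suc n) G c n<2^k dense with Fin.any? (λ v → degree G v <? D)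
  where D = 2 * ((suc k + suc k) * (suc k + suc k))
... | no none = min-degree⇒cycle G c k n<2^k λ v → ≮⇒≥ λ d<D → none (v , d<D)
... | yes (x , d<D) = delete-cycle x (dense⇒cycle k n (delete G x) (delete-colouring c x) (<-trans (n<1+n n) n<2^k)
  (+-cancelˡ-< (D + D) _ _ (<-≤-trans dense (≤-trans (degreeSum-delete G x)
    (+-monoˡ-≤ (degreeSum (delete G x)) (+-mono-≤ (<⇒≤ d<D) (<⇒≤ d<D)))))))
  where D = 2 * ((suc k + suc k) * (suc k + suc k))

-- Counting edges and the logarithmic threshold

-- Stated for `tabulate f` with arbitrary `f`, so that the tail of the list is the instance
-- `f ∘ suc`.
length-filter-≤ : ∀ {X : Set} {Q : Pred X 0ℓ} (Q? : Decidable Q) {n} (f : Fin n → X) (g : Fin n → ℕ) →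
  (∀ i → Q (f i) → 1 ≤ g i) → length (filter Q? (tabulate f)) ≤ sum g
length-filter-≤ Q? {zero}  f g _ = z≤n
length-filter-≤ Q? {suc n} f g Q⇒1 with Q? (f zero)
... | yes q = +-mono-≤ (Q⇒1 zero q) (length-filter-≤ Q? (f ∘ suc) (g ∘ suc) (Q⇒1 ∘ suc))
... | no  _ = m≤n⇒m≤o+n (g zero) (length-filter-≤ Q? (f ∘ suc) (g ∘ suc) (Q⇒1 ∘ suc))

length-filter-cartesianProduct-≤ : ∀ {X Y : Set} {Q : Pred (X × Y) 0ℓ} (Q? : Decidable Q) {m n}
  (f : Fin m → X) (h : Fin n → Y) (g : Fin m → Fin n → ℕ) → (∀ i j → Q (f i , h j) → 1 ≤ g i j) →
  length (filter Q? (cartesianProduct (tabulate f) (tabulate h))) ≤ ∑[ i < m ] ∑[ j < n ] g i j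
length-filter-cartesianProduct-≤ Q? {zero}  f h g _ = z≤n
length-filter-cartesianProduct-≤ Q? {suc m} f h g Q⇒1 = begin
  length (filter Q? (row ++ rest))          ≡⟨ cong length (filter-++ Q? row rest) ⟩
  length (filter Q? row ++ filter Q? rest)  ≡⟨ length-++ (filter Q? row) ⟩
  length (filter Q? row) + length (filter Q? rest)
    ≡⟨ cong (λ z → length (filter Q? z) + length (filter Q? rest)) (map-tabulate h (f zero ,_)) ⟩
  length (filter Q? (tabulate λ j → f zero , h j)) + length (filter Q? rest)
    ≤⟨ +-mono-≤ (length-filter-≤ Q? (λ j → f zero , h j) (g zero) (Q⇒1 zero))
                (length-filter-cartesianProduct-≤ Q? (f ∘ suc) h (g ∘ suc) (Q⇒1 ∘ suc)) ⟩
  _ ∎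
  where
  open ≤-Reasoning
  row  = map (f zero ,_) (tabulate h)
  rest = cartesianProduct (tabulate (f ∘ suc)) (tabulate h)

-- A factor of two is given away here, as the degree sum sees each edge from both ends; the constant
-- 32 leaves room for it.
edgeCount≤degreeSum : ∀ {n} (G : Graph n) → edgeCount G ≤ degreeSum G
edgeCount≤degreeSum G = length-filter-cartesianProduct-≤ _ (λ i → i) (λ j → j) (adjacency G)
  λ u v (_ , uv) → ≤-reflexive (sym (⟦⟧-yes (adj? G u v) uv))

log₂-bracket : ∀ n → 1 ≤ n → ∃[ k ] 2 ^ k ≤ n × n < 2 ^ suc k
log₂-bracket 1             _ = 0 , ≤-refl , ≤-refl
log₂-bracket (suc (suc n)) _ with log₂-bracket (suc n) (s≤s z≤n)
... | k , lo , hi with m≤n⇒m<n∨m≡n hi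
...   | inj₁ below = k , m≤n⇒m≤1+n lo , below
...   | inj₂ equal = suc k , ≤-reflexive (sym equal) ,
        subst (_< 2 ^ suc (suc k)) (sym equal) (^-monoʳ-< 2 ≤-refl (n<1+n (suc k)))

theorem1p1 : (n : ℕ) → 1 ≤ n → (G : Graph n) → (c : ProperEdgeColouring G) →
    ManyEdges n (edgeCount G) → RainbowCycle G c
theorem1p1 n 1≤n G c many with log₂-bracket n 1≤n
... | k , 2^k≤n , n<2^K = dense⇒cycle k n G c n<2^K (begin-strict
  n * (D + D)        ≡⟨ arith₁ n k ⟩
  n * (16 * (K * K)) <⟨ *-monoʳ-< n {{>-nonZero 1≤n}} (m<m+n (16 * (K * K)) {extra} (s≤s z≤n)) ⟩
  n * (16 * (K * K) + extra) ≡⟨ arith₂ n k ⟩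
  32 * n * (suc K * suc K) ≤⟨ ≮⇒≥ few ⟩
  edgeCount G * (1 * 1) ≡⟨ *-identityʳ (edgeCount G) ⟩
  edgeCount G           ≤⟨ edgeCount≤degreeSum G ⟩
  degreeSum G ∎)
  where
  open ≤-Reasoning
  K = suc k
  D = 2 * ((K + K) * (K + K))
  -- The difference `32 (k + 2)² - 16 (k + 1)²`, written as a successor to make it visibly positive.
  extra = suc (111 + 96 * k + 16 * (k * k))
  arith₁ : ∀ n k → n * (2 * ((suc k + suc k) * (suc k + suc k)) + 2 * ((suc k + suc k) * (suc k + suc k)))
                 ≡ n * (16 * (suc k * suc k))
  arith₁ = solve-∀
  arith₂ : ∀ n k → n * (16 * (suc k * suc k) + suc (111 + 96 * k + 16 * (k * k)))
                 ≡ 32 * n * (suc (suc k) * suc (suc k))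
  arith₂ = solve-∀
  4·2^k : ∀ x → 2 * (2 * x) ≡ 4 * x
  4·2^k = solve-∀
  -- The hypothesis is used at the single fraction `p / q = suc K / 1`. Since `2 ^ k ≤ n`, already
  -- `4 * 2 ^ k ≤ 5 * n`, so `log₂ (5n)` is at least `suc K` and the premise of `many` must fail.
  few : ¬ edgeCount G * (1 * 1) < 32 * n * (suc K * suc K)
  few lt = <⇒≱ (many (suc K) 1 (s≤s z≤n) lt) (begin
    2 ^ suc K     ≡⟨ 4·2^k (2 ^ k) ⟩
    4 * 2 ^ k     ≤⟨ *-mono-≤ {4} {5} (n≤1+n 4) 2^k≤n ⟩
    5 * n         ≡⟨ *-identityʳ (5 * n) ⟨
    (5 * n) ^ 1   ∎)
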